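{- Let $T$ be a finite rooted tree with root $r$ and binary diagonal labeling $\varepsilon:V(T)\to\mathbb F_2$. Then there is an integer $k\ge 0$ and a nonempty affine subspace $L_T\subseteq\mathbb F_2^2$ such that \[ N_T(\alpha,\beta)=\begin{cases}2^k, & (\alpha,\beta)\in L_T,\\ 0, & (\alpha,\beta)\notin L_T.\end{cases} \] Moreover, the pair $(L_T,k)$ is obtained recursively from the corresponding pairs of the child subtrees, as follows. Let $T_1,\ldots,T_m$ be the child subtrees of the root, rooted at the children $r_1,\ldots,r_m$ of $r$ and labeled by the restrictions of $\varepsilon$, and suppose that \[ N_{T_i}(\alpha,\beta)=2^{k_i}\,\mathbf 1_{L_i}(\alpha,\beta)\qquad(1\le i\le m), \] where $L_i\subseteq\mathbb F_2^2$ is an affine subspace and $k_i\geq 0$ is an integer. Then $L_T$ is the set of all pairs $(\alpha,\beta)\in\mathbb F_2^2$ for which there exist $\gamma_1,\ldots,\gamma_m\in\mathbb F_2$ such that \[ (\beta,\gamma_i)\in L_i\quad(1\le i\le m)\qquad\text{and}\qquad \sum_{i=1}^m\gamma_i+\varepsilon(r)\beta=\varepsilon(r)+\alpha . \] For each $(\alpha,\beta)\in L_T$, the number of such tuples $(\gamma_1,\ldots,\gamma_m)$ is independent of $(\alpha,\beta)$; if this number is $2^s$, then \[ k=\sum_{i=1}^m k_i+s . \]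
   Context: All matrices and vector spaces are over the two-element field $\mathbb F_2$. For a rooted tree $T$ with root $r$ and labeling $\varepsilon:V(T)\to\mathbb F_2$ (also viewed as a vector in $\mathbb F_2^{V(T)}$), put $M(T,\varepsilon)=A(T)+D_\varepsilon$, where $A(T)$ is the adjacency matrix of $T$ over $\mathbb F_2$ and $D_\varepsilon$ is the diagonal matrix with diagonal vector $\varepsilon$. Let $e_r$ be the standard basis vector at $r$. For $\alpha,\beta\in\mathbb F_2$ define \[ N_T(\alpha,\beta)=\#\{x\in\mathbb F_2^{V(T)} : M(T,\varepsilon)x=\varepsilon+\alpha e_r,\ x_r=\beta\}. \] $\mathbf 1_L$ denotes the indicator function of a subset $L\subseteq\mathbb F_2^2$. The child subtree at a child $r_i$ of the root is the rooted subtree consisting of $r_i$ and all its descendants, with root $r_i$; $N_{T_i}$ is defined in the same way using $T_i$, $r_i$ and the restricted labeling. -}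

module Defs where

open import Algebra.Bundles using (CommutativeRing)
import Algebra.Properties.CommutativeMonoid.Sum as MonoidSum
open import Data.Bool.Base using (Bool; true; false; if_then_else_)
  renaming (_xor_ to infixl 6 _⊕_; _∧_ to infixl 7 _⊙_)
open import Data.Bool.Properties using (xor-∧-commutativeRing)
  renaming (_≟_ to _≟𝔽₂_)
open import Data.Fin.Base using (Fin; zero; suc)
import Data.Fin.Properties as Fin
open import Data.List.Base
  using (List; []; _∷_; length; filter; cartesianProductWith)
open import Data.Nat.Base using (ℕ; zero; suc)
open import Data.Nat.Properties using (+-0-commutativeMonoid)
open import Data.Product.Base using (_×_; _,_; ∃-syntax)
open import Data.Sum.Base using (_⊎_; inj₁; inj₂)
open import Function.Base using (_∘_)
open import Function.Bundles using (_⇔_)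
open import Relation.Binary.Definitions using (DecidableEquality; Decidable)
open import Relation.Binary.PropositionalEquality using (_≡_; refl; cong)
open import Relation.Nullary.Decidable
  using (Dec; yes; no; does; map′; _×-dec_; _⊎-dec_)
open import Relation.Nullary.Negation using (¬_)
import Relation.Unary as U

-- The two-element field is the library's ring (Bool, xor, ∧), with
-- addition written ⊕ and multiplication written ⊙.

𝔽₂ : Set
𝔽₂ = Bool

pattern 𝟘 = false
pattern 𝟙 = true

module 𝔽₂-Sum =
  MonoidSum (CommutativeRing.+-commutativeMonoid xor-∧-commutativeRing)
module ℕ-Sum = MonoidSum +-0-commutativeMonoid

-- A finite rooted tree is a root together with the family of its child
-- subtrees.  The order on the children plays no role.

data Tree : Set where
  node : (m : ℕ) → (Fin m → Tree) → Tree

degree : Tree → ℕ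
degree (node m _) = m

subtree : (T : Tree) → Fin (degree T) → Tree
subtree (node _ ts) = ts

data Vertex (T : Tree) : Set where
  root  : Vertex T
  child : (i : Fin (degree T)) → Vertex (subtree T i) → Vertex T

-- u ⟶ v : v is a child of u

data _⟶_ {T : Tree} : Vertex T → Vertex T → Set where
  here  : (i : Fin (degree T)) → root ⟶ child i root
  there : (i : Fin (degree T)) {u v : Vertex (subtree T i)} →
          u ⟶ v → child i u ⟶ child i v

Adjacent : {T : Tree} → Vertex T → Vertex T → Set
Adjacent u v = (u ⟶ v) ⊎ (v ⟶ u)

_≟ⱽ_ : {T : Tree} → DecidableEquality (Vertex T)
root      ≟ⱽ root      = yes refl
root      ≟ⱽ child _ _ = no λ ()
child _ _ ≟ⱽ root      = no λ ()
child i u ≟ⱽ child j v with i Fin.≟ j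
... | no i≢j   = no λ { refl → i≢j refl }
... | yes refl = map′ (cong (child i)) (λ { refl → refl }) (u ≟ⱽ v)

_⟶?_ : {T : Tree} → Decidable (_⟶_ {T})
root      ⟶? root                = no λ ()
root      ⟶? child i root        = yes (here i)
root      ⟶? child _ (child _ _) = no λ ()
child _ _ ⟶? root                = no λ ()
child i u ⟶? child j v with i Fin.≟ j
... | no i≢j   = no λ { (there _ _) → i≢j refl }
... | yes refl = map′ (there i) (λ { (there _ p) → p }) (u ⟶? v)

adjacent? : {T : Tree} → Decidable (Adjacent {T})
adjacent? u v = (u ⟶? v) ⊎-dec (v ⟶? u)

∀ⱽ? : (T : Tree) {P : Vertex T → Set} → U.Decidable P → Dec (∀ v → P v)
∀ⱽ? (node m ts) P? =
  map′ (λ { (p , _) root → p ; (_ , q) (child i v) → q i v })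
       (λ p → p root , λ i v → p (child i v))
       (P? root ×-dec Fin.all? λ i → ∀ⱽ? (ts i) λ v → P? (child i v))

∑ⱽ : (T : Tree) → (Vertex T → 𝔽₂) → 𝔽₂
∑ⱽ (node m ts) f =
  f root ⊕ 𝔽₂-Sum.sum λ i → ∑ⱽ (ts i) λ v → f (child i v)

-- 𝔽₂-vectors indexed by the vertices; a labeling is such a vector.

Vect : Tree → Set
Vect T = Vertex T → 𝔽₂

Matrix : Tree → Set
Matrix T = Vertex T → Vertex T → 𝔽₂

restrict : {T : Tree} → Vect T → (i : Fin (degree T)) → Vect (subtree T i)
restrict ε i v = ε (child i v)

adjacencyMatrix : (T : Tree) → Matrix T
adjacencyMatrix T u v = does (adjacent? u v)

diagonal : {T : Tree} → Vect T → Matrix T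
diagonal d u v = if does (u ≟ⱽ v) then d u else 𝟘

M : (T : Tree) → Vect T → Matrix T
M T ε u v = adjacencyMatrix T u v ⊕ diagonal ε u v

_*ᵥ_ : {T : Tree} → Matrix T → Vect T → Vect T
_*ᵥ_ {T} A x u = ∑ⱽ T λ v → A u v ⊙ x v

eᵣ : {T : Tree} → Vect T
eᵣ v = does (root ≟ⱽ v)

-- Enumeration of all choice functions from finite lists.  If each list
-- contains every element of its type exactly once, the result contains
-- every dependent function exactly once, up to pointwise equality.

consΠ : {m : ℕ} {A : Fin (suc m) → Set} →
        A zero → (∀ i → A (suc i)) → ∀ i → A i
consΠ a f zero    = a
consΠ a f (suc i) = f i

choices : {m : ℕ} {A : Fin m → Set} → (∀ i → List (A i)) → List (∀ i → A i)
choices {zero}  _  = (λ ()) ∷ []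
choices {suc m} ls = cartesianProductWith consΠ (ls zero) (choices (ls ∘ suc))

all𝔽₂ : List 𝔽₂
all𝔽₂ = 𝟘 ∷ 𝟙 ∷ []

joinVect : {T : Tree} → 𝔽₂ → (∀ i → Vect (subtree T i)) → Vect T
joinVect b xs root        = b
joinVect b xs (child i v) = xs i v

allVects : (T : Tree) → List (Vect T)
allVects (node m ts) =
  cartesianProductWith joinVect all𝔽₂ (choices λ i → allVects (ts i))

allTuples : (m : ℕ) → List (Fin m → 𝔽₂)
allTuples m = choices λ _ → all𝔽₂

-- N T ε α β = #{ x : M(T,ε) x = ε + α eᵣ , x_r = β }

Solution : (T : Tree) → Vect T → 𝔽₂ → 𝔽₂ → Vect T → Set
Solution T ε α β x =
  (∀ v → (M T ε *ᵥ x) v ≡ ε v ⊕ α ⊙ eᵣ v) × x root ≡ β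

solution? : (T : Tree) (ε : Vect T) (α β : 𝔽₂) →
            U.Decidable (Solution T ε α β)
solution? T ε α β x =
  ∀ⱽ? T (λ v → (M T ε *ᵥ x) v ≟𝔽₂ (ε v ⊕ α ⊙ eᵣ v)) ×-dec (x root ≟𝔽₂ β)

N : (T : Tree) → Vect T → 𝔽₂ → 𝔽₂ → ℕ
N T ε α β = length (filter (solution? T ε α β) (allVects T))

-- Subsets of the plane 𝔽₂², given by their characteristic functions.

Plane : Set
Plane = 𝔽₂ × 𝔽₂

infixl 6 _⊕ᵖ_
infixr 7 _·ᵖ_

_⊕ᵖ_ : Plane → Plane → Plane
(a , b) ⊕ᵖ (c , d) = a ⊕ c , b ⊕ d

_·ᵖ_ : 𝔽₂ → Plane → Plane
c ·ᵖ (a , b) = c ⊙ a , c ⊙ b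

Subset : Set
Subset = Plane → Bool

infix 4 _∈_ _∉_

_∈_ : Plane → Subset → Set
p ∈ L = L p ≡ true

_∉_ : Plane → Subset → Set
p ∉ L = ¬ (p ∈ L)

𝟏 : Subset → Plane → ℕ
𝟏 L p = if L p then 1 else 0

Nonempty : Subset → Set
Nonempty L = ∃[ p ] p ∈ L

record IsLinearSubspace (W : Subset) : Set where
  field
    0∈       : (𝟘 , 𝟘) ∈ W
    ⊕-closed : ∀ {p q} → p ∈ W → q ∈ W → p ⊕ᵖ q ∈ W
    ·-closed : ∀ c {p} → p ∈ W → c ·ᵖ p ∈ W

-- The empty set counts as an affine subspace; any other one is a
-- translate p + W of a linear subspace W.

IsAffineSubspace : Subset → Set
IsAffineSubspace L =
  (∀ q → q ∉ L) ⊎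
  (∃[ p ] ∃[ W ] IsLinearSubspace W ×
     (∀ q → q ∈ L ⇔ (∃[ w ] w ∈ W × q ≡ p ⊕ᵖ w)))

-- The tuples (γ₁,…,γₘ) admissible for (α,β), given subsets Lᵢ attached to
-- the children of the root.

Admissible : (T : Tree) → Vect T → (Fin (degree T) → Subset) →
             𝔽₂ → 𝔽₂ → (Fin (degree T) → 𝔽₂) → Set
Admissible T ε Ls α β γ =
  (∀ i → (β , γ i) ∈ Ls i) ×
  𝔽₂-Sum.sum γ ⊕ ε root ⊙ β ≡ ε root ⊕ α

admissible? : (T : Tree) (ε : Vect T) (Ls : Fin (degree T) → Subset)
              (α β : 𝔽₂) → U.Decidable (Admissible T ε Ls α β)
admissible? T ε Ls α β γ =
  Fin.all? (λ i → Ls i (β , γ i) ≟𝔽₂ true) ×-dec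
  ((𝔽₂-Sum.sum γ ⊕ ε root ⊙ β) ≟𝔽₂ (ε root ⊕ α))

#admissible : (T : Tree) → Vect T → (Fin (degree T) → Subset) →
              𝔽₂ → 𝔽₂ → ℕ
#admissible T ε Ls α β =
  length (filter (admissible? T ε Ls α β) (allTuples (degree T)))

{-# OPTIONS --safe #-}
module Submission where

-- Deleting the root splits the system into the systems of the child subtrees,
-- with αᵢ = β and βᵢ = γᵢ, and the one equation at the root.  Hence N_T is a
-- sum over the tuples γ of products of the N_{Tᵢ}, and a factor 2^kᵢ comes out
-- of each of them.  Since xᵀ M x = ε · x, a solution satisfies α β = 0, so L_T
-- avoids (1 , 1); it is in fact always one of the three lines α = 0, β = 0 and
-- α + β = 1.  Attaching one child at a time, the line changes by a table of
-- nine cases, and the number of tuples γ doubles in exactly one of them.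

open import Defs
open import Data.Bool.Base using (true; false; not; if_then_else_)
  renaming (_xor_ to infixl 6 _⊕_; _∧_ to infixl 7 _⊙_)
open import Data.Bool.Properties
  using (∧-comm; ∧-identityʳ; ∧-zeroʳ; not-involutive; xor-comm;
         xor-identityʳ; ¬-not)
  renaming (_≟_ to _≟𝔽₂_)
open import Data.Fin.Base using (Fin; zero; suc)
import Data.Fin.Properties as Fin
open import Data.List.Base using (List; []; _∷_; length; map; filter; cartesianProductWith)
open import Data.List.Properties using (filter-++; length-++)
open import Data.Nat.Base using (ℕ; zero; suc; _+_; _*_; _^_; z≤n; s≤s; ≢-nonZero⁻¹)
open import Data.Nat.Properties
  using (*-assoc; *-cancelˡ-≡; *-cancelʳ-≡; *-identityʳ; *-zeroʳ; +-identityʳ;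
         ^-distribˡ-+-*; ^-monoʳ-<; <-cmp; <⇒≢; m^n≢0; m*n≡0⇒m≡0∨n≡0; m+n≡0⇒m≡0; m+n≡0⇒n≡0)
open import Data.Nat.Tactic.RingSolver using (solve-∀)
open import Data.Product.Base using (_×_; _,_; ∃-syntax; proj₁; proj₂)
open import Data.Sum.Base using (_⊎_; inj₁; inj₂)
open import Function.Base using (_∘_)
open import Function.Bundles using (_⇔_; mk⇔; module Equivalence)
open import Function.Properties.Equivalence using () renaming (trans to ⇔-trans)
open import Relation.Binary.Definitions using (tri<; tri≈; tri>)
open import Relation.Binary.PropositionalEquality
open import Relation.Nullary.Decidable
  using (yes; no; does; _×-dec_; dec-false; does-⇔)
open import Relation.Nullary.Negation using (¬_; contradiction)
import Relation.Unary as U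

open Equivalence using (to; from)

-- Linear algebra over 𝔽₂

-- In characteristic 2 a summand crosses the equality sign unchanged. This brings the equations at
-- the vertices into the form required by the child systems and by `residue`, and back.
⊕-transpose : ∀ a b {c} → a ⊕ b ≡ c ⇔ a ≡ b ⊕ c
⊕-transpose a b = mk⇔ (λ { refl → cancel a b }) (λ { refl → cancel′ b _ })
  where
  cancel : ∀ a b → a ≡ b ⊕ (a ⊕ b)
  cancel 𝟘 𝟘 = refl
  cancel 𝟘 𝟙 = refl
  cancel 𝟙 𝟘 = refl
  cancel 𝟙 𝟙 = refl

  cancel′ : ∀ b c → b ⊕ c ⊕ b ≡ c
  cancel′ 𝟘 𝟘 = refl
  cancel′ 𝟘 𝟙 = refl
  cancel′ 𝟙 𝟘 = refl
  cancel′ 𝟙 𝟙 = refl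

sum-zero : ∀ {m} {f : Fin m → 𝔽₂} → (∀ i → f i ≡ 𝟘) → 𝔽₂-Sum.sum f ≡ 𝟘
sum-zero {zero}  f≡0 = refl
sum-zero {suc m} f≡0 = cong₂ _⊕_ (f≡0 zero) (sum-zero (f≡0 ∘ suc))

sum-single : ∀ {m} {f : Fin m → 𝔽₂} (i : Fin m) →
             (∀ j → j ≢ i → f j ≡ 𝟘) → 𝔽₂-Sum.sum f ≡ f i
sum-single {f = f} zero f≡0 =
  trans (cong (f zero ⊕_) (sum-zero λ j → f≡0 (suc j) λ ())) (xor-identityʳ _)
sum-single (suc i) f≡0 =
  cong₂ _⊕_ (f≡0 zero λ ())
            (sum-single i λ j j≢i → f≡0 (suc j) λ { refl → j≢i refl })

∑ⱽ-cong : ∀ T {f g : Vect T} → (∀ v → f v ≡ g v) → ∑ⱽ T f ≡ ∑ⱽ T g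
∑ⱽ-cong (node m ts) f≗g =
  cong₂ _⊕_ (f≗g root) (𝔽₂-Sum.sum-cong-≗ λ i → ∑ⱽ-cong (ts i) (f≗g ∘ child i))

∑ⱽ-zero : ∀ T {f : Vect T} → (∀ v → f v ≡ 𝟘) → ∑ⱽ T f ≡ 𝟘
∑ⱽ-zero (node m ts) f≡0 =
  cong₂ _⊕_ (f≡0 root) (sum-zero λ i → ∑ⱽ-zero (ts i) (f≡0 ∘ child i))

∑ⱽ-root : ∀ T {f : Vect T} → (∀ i v → f (child i v) ≡ 𝟘) → ∑ⱽ T f ≡ f root
∑ⱽ-root (node m ts) {f} f≡0 =
  trans (cong (f root ⊕_) (sum-zero λ i → ∑ⱽ-zero (ts i) (f≡0 i)))
        (xor-identityʳ _)

-- Rows of the matrix in terms of the child subtrees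

module _ {m} {ts : Fin m → Tree} (ε : Vect (node m ts)) where

  private T = node m ts

  M-child-root : ∀ i u → M T ε (child i u) root ≡ eᵣ u
  M-child-root i root        = refl
  M-child-root i (child _ _) = refl

  -- The test `i Fin.≟ i` inside the decision procedures does not reduce for a variable `i`, so the
  -- entries are compared through the equivalence of the propositions that they decide.
  M-child-child : ∀ i u v → M T ε (child i u) (child i v) ≡ M (ts i) (restrict ε i) u v
  M-child-child i u v = cong₂ _⊕_
    (does-⇔ (mk⇔ (λ { (inj₁ (there _ p)) → inj₁ p ; (inj₂ (there _ p)) → inj₂ p })
                 (λ { (inj₁ p) → inj₁ (there i p) ; (inj₂ p) → inj₂ (there i p) }))
            (adjacent? (child {T} i u) (child i v)) (adjacent? u v))
    (cong (if_then ε (child i u) else 𝟘)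
      (does-⇔ (mk⇔ (λ { refl → refl }) (cong (child i)))
              (child {T} i u ≟ⱽ child i v) (u ≟ⱽ v)))

  M-child-other : ∀ {i j} → j ≢ i → ∀ u v → M T ε (child i u) (child j v) ≡ 𝟘
  M-child-other {i} {j} j≢i u v = cong₂ _⊕_
    (dec-false (adjacent? (child {T} i u) (child j v))
      λ { (inj₁ (there _ _)) → j≢i refl ; (inj₂ (there _ _)) → j≢i refl })
    (cong (if_then ε (child i u) else 𝟘)
      (dec-false (child {T} i u ≟ⱽ child j v) λ { refl → j≢i refl }))

  *ᵥ-root : ∀ x → (M T ε *ᵥ x) root ≡
                  ε root ⊙ x root ⊕ 𝔽₂-Sum.sum (λ i → x (child i root))
  -- In the row of the root, all entries below the children evaluate to 0, hence the `refl`.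
  *ᵥ-root x = cong (ε root ⊙ x root ⊕_)
    (𝔽₂-Sum.sum-cong-≗ λ i → ∑ⱽ-root (ts i) λ _ _ → refl)

  *ᵥ-child : ∀ x i u → (M T ε *ᵥ x) (child i u) ≡
                       x root ⊙ eᵣ u ⊕ (M (ts i) (restrict ε i) *ᵥ restrict x i) u
  *ᵥ-child x i u = cong₂ _⊕_
    (trans (cong (_⊙ x root) (M-child-root i u)) (∧-comm (eᵣ u) (x root)))
    (trans (sum-single i λ j j≢i →
              ∑ⱽ-zero (ts j) λ v → cong (_⊙ x (child j v)) (M-child-other j≢i u v))
           (∑ⱽ-cong (ts i) λ v → cong (_⊙ x (child i v)) (M-child-child i u v)))

-- The value that γ₁ + … + γₘ must take in the equation at a root labeled e.
residue : 𝔽₂ → 𝔽₂ → 𝔽₂ → 𝔽₂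
residue e α β = e ⊙ β ⊕ (e ⊕ α)

-- Taking γ = 1 at one child flips the sum left to the other children. Read as a flip of α, this
-- lets an induction over the children proceed with `not α`.
residue-not : ∀ e α β → residue e (not α) β ≡ not (residue e α β)
residue-not 𝟘 α β = refl
residue-not 𝟙 α 𝟘 = refl
residue-not 𝟙 α 𝟙 = refl

-- Only the linear equations of `Solution`: the value at the root is kept apart because
-- `count-choices` groups the vectors by it.
Solves : (T : Tree) → Vect T → 𝔽₂ → Vect T → Set
Solves T ε α x = ∀ v → (M T ε *ᵥ x) v ≡ ε v ⊕ α ⊙ eᵣ v

solves? : ∀ T ε α → U.Decidable (Solves T ε α)
solves? T ε α x = ∀ⱽ? T λ v → (M T ε *ᵥ x) v ≟𝔽₂ (ε v ⊕ α ⊙ eᵣ v)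

-- The edge to the root contributes x_r to the equation at rᵢ, so that xᵢ
-- solves the system of Tᵢ with parameter αᵢ = β.
solves-node : ∀ {m} {ts : Fin m → Tree} (ε : Vect (node m ts)) α x →
              Solves (node m ts) ε α x ⇔
              ((∀ i → Solves (ts i) (restrict ε i) (x root) (restrict x i)) ×
               𝔽₂-Sum.sum (λ i → x (child i root)) ≡ residue (ε root) α (x root))
solves-node {m} {ts} ε α x = mk⇔
  (λ s → (λ i v → trans (to (⊕-transpose _ _) (trans (xor-comm _ (b ⊙ eᵣ v))
                     (trans (sym (*ᵥ-child ε x i v)) (trans (s (child i v)) (at-child i v)))))
                   (xor-comm (b ⊙ eᵣ v) _))
       , to (⊕-transpose _ _) (trans (xor-comm _ (ε root ⊙ b))
           (trans (sym (*ᵥ-root ε x)) (trans (s root) at-root))))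
  λ { (s , eq) root → trans (*ᵥ-root ε x) (trans (xor-comm (ε root ⊙ b) _)
                        (trans (from (⊕-transpose _ _) eq) (sym at-root)))
    ; (s , eq) (child i v) → trans (*ᵥ-child ε x i v) (trans (xor-comm (b ⊙ eᵣ v) _)
        (trans (from (⊕-transpose _ _) (trans (s i v) (xor-comm _ (b ⊙ eᵣ v))))
               (sym (at-child i v)))) }
  where
  b : 𝔽₂
  b = x root

  at-root : ε root ⊕ α ⊙ 𝟙 ≡ ε root ⊕ α
  at-root = cong (ε root ⊕_) (∧-identityʳ α)

  at-child : ∀ i v → ε (child i v) ⊕ α ⊙ 𝟘 ≡ ε (child i v)
  at-child i v = trans (cong (ε (child i v) ⊕_) (∧-zeroʳ α)) (xor-identityʳ _)

-- Counting in lists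

count-cong : ∀ {A : Set} {P Q : A → Set} (P? : U.Decidable P) (Q? : U.Decidable Q) →
             (∀ x → does (P? x) ≡ does (Q? x)) →
             ∀ xs → length (filter P? xs) ≡ length (filter Q? xs)
count-cong P? Q? eq []       = refl
count-cong P? Q? eq (x ∷ xs) rewrite eq x with does (Q? x)
... | true  = cong suc (count-cong P? Q? eq xs)
... | false = count-cong P? Q? eq xs

count-none : ∀ {A : Set} {P : A → Set} (P? : U.Decidable P) →
             (∀ x → ¬ P x) → ∀ xs → length (filter P? xs) ≡ 0
count-none P? ¬P []       = refl
count-none P? ¬P (x ∷ xs) rewrite dec-false (P? x) (¬P x) = count-none P? ¬P xs

count-map : ∀ {A B : Set} {P : B → Set} (P? : U.Decidable P) (f : A → B) xs →
            length (filter P? (map f xs)) ≡ length (filter (P? ∘ f) xs)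
count-map P? f []       = refl
count-map P? f (x ∷ xs) with does (P? (f x))
... | true  = cong suc (count-map P? f xs)
... | false = count-map P? f xs

count-cartesian : ∀ {A B C : Set} {P : C → Set} (P? : U.Decidable P) (g : A → B → C) x xs ys →
                  length (filter P? (cartesianProductWith g (x ∷ xs) ys)) ≡
                  length (filter (P? ∘ g x) ys) +
                  length (filter P? (cartesianProductWith g xs ys))
count-cartesian P? g x xs ys =
  trans (cong length (filter-++ P? (map (g x) ys) _))
        (trans (length-++ (filter P? (map (g x) ys)))
               (cong (_+ _) (count-map P? (g x) ys)))

-- conv w c is the sum of ∏ᵢ w i (γ i) over all tuples γ with sum c.
conv : ∀ {m} → (Fin m → 𝔽₂ → ℕ) → 𝔽₂ → ℕ
conv {zero}  w c = if c then 0 else 1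
conv {suc m} w c = w zero 𝟘 * conv (w ∘ suc) c + w zero 𝟙 * conv (w ∘ suc) (not c)

conv-cong : ∀ {m} {w w′ : Fin m → 𝔽₂ → ℕ} → (∀ i γ → w i γ ≡ w′ i γ) →
            ∀ c → conv w c ≡ conv w′ c
conv-cong {zero}  eq c = refl
conv-cong {suc m} eq c = cong₂ _+_
  (cong₂ _*_ (eq zero 𝟘) (conv-cong (eq ∘ suc) c))
  (cong₂ _*_ (eq zero 𝟙) (conv-cong (eq ∘ suc) (not c)))

conv-scale : ∀ {m} (ks : Fin m → ℕ) (w : Fin m → 𝔽₂ → ℕ) c →
             conv (λ i γ → 2 ^ ks i * w i γ) c ≡ 2 ^ ℕ-Sum.sum ks * conv w c
conv-scale {zero}  ks w c = sym (+-identityʳ _)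
conv-scale {suc m} ks w c
  rewrite conv-scale (ks ∘ suc) (w ∘ suc) c
        | conv-scale (ks ∘ suc) (w ∘ suc) (not c)
        | ^-distribˡ-+-* 2 (ks zero) (ℕ-Sum.sum (ks ∘ suc)) =
  lemma (2 ^ ks zero) (2 ^ ℕ-Sum.sum (ks ∘ suc)) (w zero 𝟘) (w zero 𝟙) _ _
  where
  lemma : ∀ p q a b x y → p * a * (q * x) + p * b * (q * y) ≡ p * q * (a * x + b * y)
  lemma = solve-∀

-- Nothing cancels in ℕ: a sum of products is nonzero exactly when one of its terms has no zero
-- factor.
conv-support : ∀ {m} (w : Fin m → 𝔽₂ → ℕ) c →
               conv w c ≢ 0 ⇔ (∃[ γ ] (∀ i → w i (γ i) ≢ 0) × 𝔽₂-Sum.sum γ ≡ c)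
conv-support {zero} w 𝟘 = mk⇔ (λ _ → (λ ()) , (λ ()) , refl) (λ _ ())
conv-support {zero} w 𝟙 = mk⇔ (λ 0≢0 → contradiction refl 0≢0) (λ ())
conv-support {suc m} w c = mk⇔ support⇒ ⇒support
  where
  ih = conv-support (w ∘ suc)

  *-≢0 : ∀ a b → a * b ≢ 0 → a ≢ 0 × b ≢ 0
  *-≢0 a b ab≢0 = (λ { refl → ab≢0 refl }) , (λ { refl → ab≢0 (*-zeroʳ a) })

  ≢0-* : ∀ a b → a ≢ 0 → b ≢ 0 → a * b ≢ 0
  ≢0-* a b a≢0 b≢0 ab≡0 with m*n≡0⇒m≡0∨n≡0 a ab≡0
  ... | inj₁ a≡0 = a≢0 a≡0
  ... | inj₂ b≡0 = b≢0 b≡0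

  +-≢0 : ∀ a b → a + b ≢ 0 → a ≢ 0 ⊎ b ≢ 0
  +-≢0 zero    b b≢0 = inj₂ b≢0
  +-≢0 (suc a) b _   = inj₁ λ ()

  support⇒ : conv w c ≢ 0 → ∃[ γ ] (∀ i → w i (γ i) ≢ 0) × 𝔽₂-Sum.sum γ ≡ c
  support⇒ ≢0 with +-≢0 (w zero 𝟘 * conv (w ∘ suc) c) _ ≢0
  ... | inj₁ ax≢0 = let a≢0 , x≢0 = *-≢0 (w zero 𝟘) _ ax≢0
                        γ , γ≢0 , sum≡c = to (ih c) x≢0
                    in consΠ 𝟘 γ , (λ { zero → a≢0 ; (suc i) → γ≢0 i }) , sum≡c
  ... | inj₂ by≢0 = let b≢0 , y≢0 = *-≢0 (w zero 𝟙) _ by≢0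
                        γ , γ≢0 , sum≡c = to (ih (not c)) y≢0
                    in consΠ 𝟙 γ , (λ { zero → b≢0 ; (suc i) → γ≢0 i }) ,
                       trans (cong not sum≡c) (not-involutive c)

  ⇒support : (∃[ γ ] (∀ i → w i (γ i) ≢ 0) × 𝔽₂-Sum.sum γ ≡ c) → conv w c ≢ 0
  ⇒support (γ , γ≢0 , refl) ≡0 with γ zero | γ≢0 zero
  ... | 𝟘 | a≢0 = ≢0-* _ _ a≢0 (from (ih _) (γ ∘ suc , γ≢0 ∘ suc , refl))
                    (m+n≡0⇒m≡0 (w zero 𝟘 * _) ≡0)
  ... | 𝟙 | b≢0 = ≢0-* _ _ b≢0 (from (ih _) (γ ∘ suc , γ≢0 ∘ suc , sym (not-involutive _)))
                    (m+n≡0⇒n≡0 (w zero 𝟘 * _) ≡0)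

-- Common form of the two counts. For `N`, the elements of `A i` are vectors on the i-th subtree and
-- `val` reads off the root coordinate; for the admissible tuples, `A i` is 𝔽₂ and `val` is the
-- identity.
module _ {m} {A : Fin m → Set} {P : ∀ i → A i → Set}
         (P? : ∀ i → U.Decidable (P i)) (val : ∀ i → A i → 𝔽₂) where

  Choice : 𝔽₂ → (∀ i → A i) → Set
  Choice c f = (∀ i → P i (f i)) × 𝔽₂-Sum.sum (λ i → val i (f i)) ≡ c

  choice? : ∀ c → U.Decidable (Choice c)
  choice? c f = Fin.all? (λ i → P? i (f i)) ×-dec (𝔽₂-Sum.sum (λ i → val i (f i)) ≟𝔽₂ c)

  value? : ∀ i γ → U.Decidable (λ a → P i a × val i a ≡ γ)
  value? i γ a = P? i a ×-dec (val i a ≟𝔽₂ γ)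

-- Choices with a prescribed tuple of values are counted by a product over the indices, and `conv`
-- sums these products over the tuples. The outer induction is on the number of lists, the inner
-- one, `go`, on the first list.
count-choices : ∀ {m} {A : Fin m → Set} {P : ∀ i → A i → Set}
                (P? : ∀ i → U.Decidable (P i)) (val : ∀ i → A i → 𝔽₂)
                (ls : ∀ i → List (A i)) c →
                length (filter (choice? P? val c) (choices ls)) ≡
                conv (λ i γ → length (filter (value? P? val i γ) (ls i))) c
count-choices {zero} P? val ls 𝟘 = refl
count-choices {zero} P? val ls 𝟙 = refl
count-choices {suc m} {A} {P} P? val ls c = go (ls zero)
  where
  P?′   = λ i → P? (suc i)
  val′  = λ i → val (suc i)
  rest  = conv (λ i γ → length (filter (value? P?′ val′ i γ) (ls (suc i))))

  #first : A zero → ℕ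
  #first a = length (filter (choice? P? val c ∘ consΠ a) (choices (ls ∘ suc)))

  #value : 𝔽₂ → List (A zero) → ℕ
  #value γ = length ∘ filter (value? P? val zero γ)

  #first-none : ∀ a → ¬ P zero a → #first a ≡ 0
  #first-none a ¬p = count-none (choice? P? val c ∘ consΠ a) (λ _ (ps , _) → ¬p (ps zero))
                                 (choices (ls ∘ suc))

  -- The target `c′` for the remaining entries is characterized by `shift` and not computed from
  -- `val zero a`, so that `split` can supply `c` or `not c` after its case distinction.
  #first-rest : ∀ a c′ → P zero a → (∀ s → val zero a ⊕ s ≡ c ⇔ s ≡ c′) → #first a ≡ rest c′
  #first-rest a c′ p shift = trans
    (count-cong (choice? P? val c ∘ consΠ a) (choice? P?′ val′ c′)
      (λ f → does-⇔ (mk⇔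
        (λ (ps , eq) → ps ∘ suc , to (shift _) eq)
        (λ (ps , eq) → (λ { zero → p ; (suc i) → ps i }) , from (shift _) eq))
        (choice? P? val c (consΠ a f)) (choice? P?′ val′ c′ f))
      (choices (ls ∘ suc)))
    (count-choices P?′ val′ (ls ∘ suc) c′)

  -- The count is passed as a variable n so that the case distinctions on
  -- P? zero a and val zero a do not rewrite inside it.
  split : ∀ a n → (¬ P zero a → n ≡ 0) →
          (∀ c′ → P zero a → (∀ s → val zero a ⊕ s ≡ c ⇔ s ≡ c′) → n ≡ rest c′) →
          n ≡ #value 𝟘 (a ∷ []) * rest c + #value 𝟙 (a ∷ []) * rest (not c)
  split a n none some with P? zero a
  ... | no ¬p = none ¬p
  ... | yes p with val zero a
  ...   | 𝟘 = trans (some c p λ s → mk⇔ (λ eq → eq) (λ eq → eq))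
                    (sym (trans (+-identityʳ _) (+-identityʳ _)))
  ...   | 𝟙 = trans (some (not c) p λ s → mk⇔ (λ { refl → sym (not-involutive s) })
                                              (λ { refl → not-involutive c }))
                    (sym (+-identityʳ _))

  #value-∷ : ∀ γ a l → #value γ (a ∷ l) ≡ #value γ (a ∷ []) + #value γ l
  #value-∷ γ a l = trans (cong length (filter-++ (value? P? val zero γ) (a ∷ []) l))
                         (length-++ (filter (value? P? val zero γ) (a ∷ [])))

  go : ∀ l → length (filter (choice? P? val c) (cartesianProductWith consΠ l (choices (ls ∘ suc)))) ≡
             #value 𝟘 l * rest c + #value 𝟙 l * rest (not c)
  go []      = refl
  go (a ∷ l) = trans (count-cartesian (choice? P? val c) consΠ a l (choices (ls ∘ suc)))
    (trans (cong₂ _+_ (split a (#first a) (#first-none a) (#first-rest a)) (go l))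
    (trans (collect (#value 𝟘 (a ∷ [])) (#value 𝟙 (a ∷ [])) (#value 𝟘 l) (#value 𝟙 l) _ _)
           (sym (cong₂ (λ u v → u * rest c + v * rest (not c)) (#value-∷ 𝟘 a l) (#value-∷ 𝟙 a l)))))
    where
    collect : ∀ a b a′ b′ x y →
              a * x + b * y + (a′ * x + b′ * y) ≡ (a + a′) * x + (b + b′) * y
    collect = solve-∀

-- Solutions and admissible tuples counted by convolutions

N-node : ∀ {m} {ts : Fin m → Tree} (ε : Vect (node m ts)) α β →
         N (node m ts) ε α β ≡
         conv (λ i γ → N (ts i) (restrict ε i) β γ) (residue (ε root) α β)
N-node {m} {ts} ε α β =
  trans (count-cartesian (solution? T ε α β) joinVect 𝟘 (𝟙 ∷ []) xss)
        (trans (cong (#with-root 𝟘 +_) (count-cartesian (solution? T ε α β) joinVect 𝟙 [] xss))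
               (add β refl))
  where
  T   = node m ts
  xss = choices λ i → allVects (ts i)
  -- With these `P?` and `val`, `value?` unfolds to `solution?` for the subtree, so the weights of
  -- the convolution are the numbers `N` of the children.
  P?  = λ i → solves? (ts i) (restrict ε i) β
  val : ∀ i → Vect (ts i) → 𝔽₂
  val i x = x root
  c   = residue (ε root) α β

  #with-root : 𝔽₂ → ℕ
  #with-root b = length (filter (solution? T ε α β ∘ joinVect b) xss)

  same : #with-root β ≡ conv (λ i γ → N (ts i) (restrict ε i) β γ) c
  same = trans
    (count-cong (solution? T ε α β ∘ joinVect β) (choice? P? val c)
      (λ xs → does-⇔ (mk⇔ (λ (s , _) → to (solves-node ε α (joinVect β xs)) s)
                          (λ s → from (solves-node ε α (joinVect β xs)) s , refl))
                     (solution? T ε α β (joinVect β xs)) (choice? P? val c xs))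
      xss)
    (count-choices P? val (λ i → allVects (ts i)) c)

  other : ∀ {b} → b ≢ β → #with-root b ≡ 0
  other b≢β = count-none (solution? T ε α β ∘ joinVect _) (λ _ (_ , b≡β) → b≢β b≡β) xss

  -- Only the root value β contributes. The final `+ 0` is the count over the empty rest of `all𝔽₂`.
  add : ∀ b → b ≡ β → #with-root 𝟘 + (#with-root 𝟙 + 0) ≡
                      conv (λ i γ → N (ts i) (restrict ε i) β γ) c
  add 𝟘 refl rewrite other {𝟙} (λ ()) = trans (+-identityʳ _) same
  add 𝟙 refl rewrite other {𝟘} (λ ()) = trans (+-identityʳ _) same

#admissible-conv : ∀ T ε Ls α β →
                   #admissible T ε Ls α β ≡
                   conv (λ i γ → 𝟏 (Ls i) (β , γ)) (residue (ε root) α β)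
#admissible-conv T ε Ls α β = trans
  (count-cong (admissible? T ε Ls α β) (choice? P? val c)
    (λ γ → does-⇔ (mk⇔ (λ (p , eq) → p , to (⊕-transpose _ _) eq)
                       (λ (p , eq) → p , from (⊕-transpose _ _) eq))
                  (admissible? T ε Ls α β γ) (choice? P? val c γ))
    (allTuples (degree T)))
  (trans (count-choices P? val (λ _ → all𝔽₂) c) (conv-cong single c))
  where
  P? = λ i γ → Ls i (β , γ) ≟𝔽₂ true
  val : Fin (degree T) → 𝔽₂ → 𝔽₂
  val _ γ = γ
  c = residue (ε root) α β

  -- γ occurs once in `all𝔽₂`. The membership test precedes the comparison with γ in the filter, so
  -- both points must be split before it evaluates.
  single : ∀ i γ → length (filter (value? P? val i γ) all𝔽₂) ≡ 𝟏 (Ls i) (β , γ)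
  single i 𝟘 with Ls i (β , 𝟘)
  single i 𝟘 | 𝟘 with Ls i (β , 𝟙)
  ... | 𝟘 = refl
  ... | 𝟙 = refl
  single i 𝟘 | 𝟙 with Ls i (β , 𝟙)
  ... | 𝟘 = refl
  ... | 𝟙 = refl
  single i 𝟙 with Ls i (β , 𝟘)
  single i 𝟙 | 𝟘 with Ls i (β , 𝟙)
  ... | 𝟘 = refl
  ... | 𝟙 = refl
  single i 𝟙 | 𝟙 with Ls i (β , 𝟙)
  ... | 𝟘 = refl
  ... | 𝟙 = refl

admissible-support : ∀ T ε Ls α β →
                     conv (λ i γ → 𝟏 (Ls i) (β , γ)) (residue (ε root) α β) ≢ 0 ⇔
                     (∃[ γ ] Admissible T ε Ls α β γ)
admissible-support T ε Ls α β = ⇔-trans (conv-support _ _) (mk⇔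
  (λ (γ , p , eq) → γ , (λ i → 𝟏≢0⇒∈ i (p i)) , from (⊕-transpose _ _) eq)
  (λ (γ , p , eq) → γ , (λ i → ∈⇒𝟏≢0 i (p i)) , to (⊕-transpose _ _) eq))
  where
  𝟏≢0⇒∈ : ∀ i {p} → 𝟏 (Ls i) p ≢ 0 → p ∈ Ls i
  𝟏≢0⇒∈ i {p} ≢0 with Ls i p
  ... | true  = refl
  ... | false = contradiction refl ≢0

  ∈⇒𝟏≢0 : ∀ i {p} → p ∈ Ls i → 𝟏 (Ls i) p ≢ 0
  ∈⇒𝟏≢0 i eq rewrite eq = λ ()

-- The lines avoiding (1 , 1)

data Line : Set where
  [α≡0] [β≡0] [α≢β] : Line

⟦_⟧ : Line → Subset
⟦ [α≡0] ⟧ (α , β) = not α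
⟦ [β≡0] ⟧ (α , β) = not β
⟦ [α≢β] ⟧ (α , β) = α ⊕ β

point : Line → Plane
point [α≡0] = 𝟘 , 𝟘
point [β≡0] = 𝟘 , 𝟘
point [α≢β] = 𝟘 , 𝟙

point-∈ : ∀ t → point t ∈ ⟦ t ⟧
point-∈ [α≡0] = refl
point-∈ [β≡0] = refl
point-∈ [α≢β] = refl

-- Only the line α + β = 1 misses the origin; its direction is the diagonal α = β.
direction : Line → Subset
direction [α≡0] = ⟦ [α≡0] ⟧
direction [β≡0] = ⟦ [β≡0] ⟧
direction [α≢β] (α , β) = not (α ⊕ β)

direction-linear : ∀ t → IsLinearSubspace (direction t)
direction-linear t = record
  { 0∈ = 0∈ t ; ⊕-closed = λ {p} {q} → ⊕-closed t p q ; ·-closed = λ c {p} → ·-closed t c p }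
  where
  0∈ : ∀ t → (𝟘 , 𝟘) ∈ direction t
  0∈ [α≡0] = refl
  0∈ [β≡0] = refl
  0∈ [α≢β] = refl

  ⊕-closed : ∀ t p q → p ∈ direction t → q ∈ direction t → p ⊕ᵖ q ∈ direction t
  ⊕-closed [α≡0] (𝟘 , _) (𝟘 , _) _ _ = refl
  ⊕-closed [β≡0] (_ , 𝟘) (_ , 𝟘) _ _ = refl
  ⊕-closed [α≢β] (𝟘 , 𝟘) q       _ q∈ = q∈
  ⊕-closed [α≢β] (𝟙 , 𝟙) (𝟘 , 𝟘) _ _ = refl
  ⊕-closed [α≢β] (𝟙 , 𝟙) (𝟙 , 𝟙) _ _ = refl

  ·-closed : ∀ t c p → p ∈ direction t → c ·ᵖ p ∈ direction t
  ·-closed t 𝟘 p _  = 0∈ t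
  ·-closed t 𝟙 p p∈ = p∈

⟦⟧-affine : ∀ t → IsAffineSubspace ⟦ t ⟧
⟦⟧-affine t = inj₂ (point t , direction t , direction-linear t , λ q → mk⇔
  -- In characteristic 2 translation by `point t` is its own inverse, which yields the witness.
  (λ q∈ → point t ⊕ᵖ q , trans (translate t (point t ⊕ᵖ q)) (trans (cong ⟦ t ⟧ (involutive (point t) q)) q∈)
        , sym (involutive (point t) q))
  (λ { (w , w∈ , refl) → trans (sym (translate t w)) w∈ }))
  where
  involutive : ∀ p q → p ⊕ᵖ (p ⊕ᵖ q) ≡ q
  involutive (a , b) (c , d) = cong₂ _,_ (lemma a c) (lemma b d)
    where
    lemma : ∀ a b → a ⊕ (a ⊕ b) ≡ b
    lemma 𝟘 b = refl
    lemma 𝟙 b = not-involutive b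

  translate : ∀ t w → direction t w ≡ ⟦ t ⟧ (point t ⊕ᵖ w)
  translate [α≡0] w       = refl
  translate [β≡0] w       = refl
  translate [α≢β] (𝟘 , b) = refl
  translate [α≢β] (𝟙 , 𝟘) = refl
  translate [α≢β] (𝟙 , 𝟙) = refl

-- Effect on the line of a rooted tree of attaching one more child subtree at
-- the root; the number of admissible tuples doubles when `doubling` is 1.
attach : Line → Line → Line
attach [α≡0] t     = [β≡0]
attach [β≡0] t     = t
attach [α≢β] [α≡0] = [α≢β]
attach [α≢β] [β≡0] = [β≡0]
attach [α≢β] [α≢β] = [α≡0]

doubling : Line → Line → ℕ
doubling [α≡0] [β≡0] = 1
doubling _     _     = 0

-- The left side is one step of `conv`: `t` is the line of the new child, `u` that of the tree so
-- far, and γ = 1 flips α. A child with line α = 0 forces β = 0 and leaves γ free; with β = 0 it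
-- forces γ = 0; with α + β = 1 it forces γ = 1 + β. Both values of γ survive only for a free γ and
-- a `u` that does not restrict α.
attach-correct : ∀ t u α β →
  𝟏 ⟦ t ⟧ (β , 𝟘) * 𝟏 ⟦ u ⟧ (α , β) + 𝟏 ⟦ t ⟧ (β , 𝟙) * 𝟏 ⟦ u ⟧ (not α , β) ≡
  2 ^ doubling t u * 𝟏 ⟦ attach t u ⟧ (α , β)
attach-correct [α≡0] [α≡0] 𝟘 𝟘 = refl
attach-correct [α≡0] [α≡0] 𝟘 𝟙 = refl
attach-correct [α≡0] [α≡0] 𝟙 𝟘 = refl
attach-correct [α≡0] [α≡0] 𝟙 𝟙 = refl
attach-correct [α≡0] [β≡0] 𝟘 𝟘 = refl
attach-correct [α≡0] [β≡0] 𝟘 𝟙 = refl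
attach-correct [α≡0] [β≡0] 𝟙 𝟘 = refl
attach-correct [α≡0] [β≡0] 𝟙 𝟙 = refl
attach-correct [α≡0] [α≢β] 𝟘 𝟘 = refl
attach-correct [α≡0] [α≢β] 𝟘 𝟙 = refl
attach-correct [α≡0] [α≢β] 𝟙 𝟘 = refl
attach-correct [α≡0] [α≢β] 𝟙 𝟙 = refl
attach-correct [β≡0] u     α β = +-identityʳ _
attach-correct [α≢β] [α≡0] 𝟘 𝟘 = refl
attach-correct [α≢β] [α≡0] 𝟘 𝟙 = refl
attach-correct [α≢β] [α≡0] 𝟙 𝟘 = refl
attach-correct [α≢β] [α≡0] 𝟙 𝟙 = refl
attach-correct [α≢β] [β≡0] 𝟘 𝟘 = refl
attach-correct [α≢β] [β≡0] 𝟘 𝟙 = refl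
attach-correct [α≢β] [β≡0] 𝟙 𝟘 = refl
attach-correct [α≢β] [β≡0] 𝟙 𝟙 = refl
attach-correct [α≢β] [α≢β] 𝟘 𝟘 = refl
attach-correct [α≢β] [α≢β] 𝟘 𝟙 = refl
attach-correct [α≢β] [α≢β] 𝟙 𝟘 = refl
attach-correct [α≢β] [α≢β] 𝟙 𝟙 = refl

-- A root without children has the single equation e β = e + α, which is α = 0 for e = 0 and α + β =
-- 1 for e = 1.
rootLine : ∀ {m} → 𝔽₂ → (Fin m → Line) → Line
rootLine {zero}  𝟘 ls = [α≡0]
rootLine {zero}  𝟙 ls = [α≢β]
rootLine {suc m} e ls = attach (ls zero) (rootLine e (ls ∘ suc))

-- The exponent s of the theorem, as the number of doublings met while attaching the children.
slack : ∀ {m} → 𝔽₂ → (Fin m → Line) → ℕ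
slack {zero}  e ls = 0
slack {suc m} e ls = doubling (ls zero) (rootLine e (ls ∘ suc)) + slack e (ls ∘ suc)

conv-lines : ∀ {m} e (ls : Fin m → Line) α β →
             conv (λ i γ → 𝟏 ⟦ ls i ⟧ (β , γ)) (residue e α β) ≡
             2 ^ slack e ls * 𝟏 ⟦ rootLine e ls ⟧ (α , β)
conv-lines {zero} 𝟘 ls 𝟘 β = refl
conv-lines {zero} 𝟘 ls 𝟙 β = refl
conv-lines {zero} 𝟙 ls 𝟘 𝟘 = refl
conv-lines {zero} 𝟙 ls 𝟘 𝟙 = refl
conv-lines {zero} 𝟙 ls 𝟙 𝟘 = refl
conv-lines {zero} 𝟙 ls 𝟙 𝟙 = refl
conv-lines {suc m} e ls α β
  rewrite sym (residue-not e α β)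
        | conv-lines e (ls ∘ suc) α β
        | conv-lines e (ls ∘ suc) (not α) β
        | ^-distribˡ-+-* 2 (doubling (ls zero) (rootLine e (ls ∘ suc))) (slack e (ls ∘ suc)) =
  begin
    a₀ * (s * x₀) + a₁ * (s * x₁)  ≡⟨ factor a₀ a₁ s x₀ x₁ ⟩
    s * (a₀ * x₀ + a₁ * x₁)        ≡⟨ cong (s *_) (attach-correct (ls zero) t α β) ⟩
    s * (d * y)                    ≡⟨ swap s d y ⟩
    d * s * y                      ∎
  where
  open ≡-Reasoning
  t  = rootLine e (ls ∘ suc)
  s  = 2 ^ slack e (ls ∘ suc)
  d  = 2 ^ doubling (ls zero) t
  a₀ = 𝟏 ⟦ ls zero ⟧ (β , 𝟘)
  a₁ = 𝟏 ⟦ ls zero ⟧ (β , 𝟙)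
  x₀ = 𝟏 ⟦ t ⟧ (α , β)
  x₁ = 𝟏 ⟦ t ⟧ (not α , β)
  y  = 𝟏 ⟦ attach (ls zero) t ⟧ (α , β)

  factor : ∀ a b s x y → a * (s * x) + b * (s * y) ≡ s * (a * x + b * y)
  factor = solve-∀

  swap : ∀ s d y → s * (d * y) ≡ d * s * y
  swap = solve-∀

-- The line and the exponent of a whole tree

line : (T : Tree) → Vect T → Line
line (node m ts) ε = rootLine (ε root) λ i → line (ts i) (restrict ε i)

exponent : (T : Tree) → Vect T → ℕ
exponent (node m ts) ε =
  ℕ-Sum.sum (λ i → exponent (ts i) (restrict ε i)) +
  slack (ε root) λ i → line (ts i) (restrict ε i)

N-line : ∀ T ε α β → N T ε α β ≡ 2 ^ exponent T ε * 𝟏 ⟦ line T ε ⟧ (α , β)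
N-line (node m ts) ε α β = begin
  N (node m ts) ε α β
    ≡⟨ N-node ε α β ⟩
  conv (λ i γ → N (ts i) (restrict ε i) β γ) c
    ≡⟨ conv-cong (λ i γ → N-line (ts i) (restrict ε i) β γ) c ⟩
  conv (λ i γ → 2 ^ ks i * 𝟏 ⟦ ls i ⟧ (β , γ)) c
    ≡⟨ conv-scale ks (λ i γ → 𝟏 ⟦ ls i ⟧ (β , γ)) c ⟩
  2 ^ ℕ-Sum.sum ks * conv (λ i γ → 𝟏 ⟦ ls i ⟧ (β , γ)) c
    ≡⟨ cong (2 ^ ℕ-Sum.sum ks *_) (conv-lines (ε root) ls α β) ⟩
  2 ^ ℕ-Sum.sum ks * (2 ^ slack (ε root) ls * 𝟏 ⟦ rootLine (ε root) ls ⟧ (α , β))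
    ≡⟨ *-assoc (2 ^ ℕ-Sum.sum ks) _ _ ⟨
  2 ^ ℕ-Sum.sum ks * 2 ^ slack (ε root) ls * 𝟏 ⟦ rootLine (ε root) ls ⟧ (α , β)
    ≡⟨ cong (_* 𝟏 ⟦ rootLine (ε root) ls ⟧ (α , β)) (^-distribˡ-+-* 2 (ℕ-Sum.sum ks) (slack (ε root) ls)) ⟨
  2 ^ (ℕ-Sum.sum ks + slack (ε root) ls) * 𝟏 ⟦ rootLine (ε root) ls ⟧ (α , β) ∎
  where
  open ≡-Reasoning
  c  = residue (ε root) α β
  ks = λ i → exponent (ts i) (restrict ε i)
  ls = λ i → line (ts i) (restrict ε i)

-- Uniqueness of the pair (L, k)

2^-injective : ∀ m n → 2 ^ m ≡ 2 ^ n → m ≡ n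
2^-injective m n eq with <-cmp m n
... | tri< m<n _ _ = contradiction eq (<⇒≢ (^-monoʳ-< 2 (s≤s (s≤s z≤n)) m<n))
... | tri≈ _ m≡n _ = m≡n
... | tri> _ _ n<m = contradiction (sym eq) (<⇒≢ (^-monoʳ-< 2 (s≤s (s≤s z≤n)) n<m))

-- At a point of `L` the common value is the nonzero number 2^k, so the point lies in `L′` too and
-- the exponents agree; then the power cancels everywhere. For an empty `L` the exponent would be
-- arbitrary.
scaled-𝟏-injective : ∀ k k′ {L L′} → Nonempty L →
                     (∀ p → 2 ^ k * 𝟏 L p ≡ 2 ^ k′ * 𝟏 L′ p) →
                     k ≡ k′ × (∀ p → 𝟏 L p ≡ 𝟏 L′ p)
scaled-𝟏-injective k k′ {L} {L′} (p₀ , p₀∈L) eq = k≡k′ , λ p →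
  *-cancelˡ-≡ _ _ (2 ^ k) {{m^n≢0 2 k}} (trans (eq p) (cong (λ j → 2 ^ j * 𝟏 L′ p) (sym k≡k′)))
  where
  k≡k′ : k ≡ k′
  k≡k′ with eq p₀
  ... | eq₀ rewrite p₀∈L with L′ p₀
  ...   | true  = 2^-injective k k′ (*-cancelʳ-≡ _ _ 1 eq₀)
  ...   | false = contradiction (trans (sym (*-identityʳ _)) (trans eq₀ (*-zeroʳ (2 ^ k′))))
                                (≢-nonZero⁻¹ _ {{m^n≢0 2 k}})

-- Puts membership into the nonvanishing form in which `conv-support` expresses the existence of a
-- tuple.
∈⇔scaled-𝟏≢0 : ∀ k L p → p ∈ L ⇔ 2 ^ k * 𝟏 L p ≢ 0
∈⇔scaled-𝟏≢0 k L p with L p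
... | true  = mk⇔ (λ _ → subst (_≢ 0) (sym (*-identityʳ _)) (≢-nonZero⁻¹ _ {{m^n≢0 2 k}})) (λ _ → refl)
... | false = mk⇔ (λ ()) (λ ≢0 → contradiction (*-zeroʳ (2 ^ k)) ≢0)

theorem1p4 : (T : Tree) (ε : Vect T) →
    ∃[ k ] ∃[ L ]
    IsAffineSubspace L × Nonempty L ×
    (∀ α β → ((α , β) ∈ L → N T ε α β ≡ 2 ^ k) ×
    ((α , β) ∉ L → N T ε α β ≡ 0)) ×
    ((Ls : Fin (degree T) → Subset) (ks : Fin (degree T) → ℕ) →
    (∀ i → IsAffineSubspace (Ls i)) →
    (∀ i α β → N (subtree T i) (restrict ε i) α β ≡ 2 ^ ks i * 𝟏 (Ls i) (α , β)) →
    (∀ α β → (α , β) ∈ L ⇔ (∃[ γ ] Admissible T ε Ls α β γ)) ×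
    (∃[ s ] (∀ α β → (α , β) ∈ L → #admissible T ε Ls α β ≡ 2 ^ s) ×
    k ≡ ℕ-Sum.sum ks + s))
theorem1p4 T@(node m ts) ε =
  exponent T ε , ⟦ line T ε ⟧ , ⟦⟧-affine (line T ε) , (point (line T ε) , point-∈ (line T ε)) ,
  (λ α β → inside α β , outside α β) , recursion
  where
  k = exponent T ε
  L = ⟦ line T ε ⟧

  inside : ∀ α β → (α , β) ∈ L → N T ε α β ≡ 2 ^ k
  inside α β ∈L = trans (N-line T ε α β)
    (trans (cong (λ b → 2 ^ k * (if b then 1 else 0)) ∈L) (*-identityʳ _))

  outside : ∀ α β → (α , β) ∉ L → N T ε α β ≡ 0
  outside α β ∉L = trans (N-line T ε α β)
    (trans (cong (λ b → 2 ^ k * (if b then 1 else 0)) (¬-not ∉L)) (*-zeroʳ (2 ^ k)))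

  recursion : ∀ Ls ks → _ → _ → _
  recursion Ls ks _ N≡ =
    (λ α β → ⇔-trans (∈⇔scaled-𝟏≢0 s L (α , β))
               (⇔-trans (mk⇔ (subst (_≢ 0) (sym (conv≡ α β))) (subst (_≢ 0) (conv≡ α β)))
                        (admissible-support T ε Ls α β))) ,
    s ,
    (λ α β ∈L → trans (#admissible-conv T ε Ls α β) (trans (conv≡ α β)
       (trans (cong (λ b → 2 ^ s * (if b then 1 else 0)) ∈L) (*-identityʳ _)))) ,
    cong (_+ s) (ℕ-Sum.sum-cong-≗ (proj₁ ∘ unique))
    where
    ls : Fin m → Line
    ls i = line (ts i) (restrict ε i)

    s : ℕ
    s = slack (ε root) ls

    -- The given pair and the computed one describe the same function `N` of the i-th subtree, and
    -- the computed line is nonempty.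
    unique : ∀ i → exponent (ts i) (restrict ε i) ≡ ks i × (∀ p → 𝟏 ⟦ ls i ⟧ p ≡ 𝟏 (Ls i) p)
    unique i = scaled-𝟏-injective _ (ks i) (point (ls i) , point-∈ (ls i))
      λ (α , β) → trans (sym (N-line (ts i) (restrict ε i) α β)) (N≡ i α β)

    -- The sets `Ls i` agree with the computed lines only pointwise, so they are exchanged inside
    -- the convolution.
    conv≡ : ∀ α β → conv (λ i γ → 𝟏 (Ls i) (β , γ)) (residue (ε root) α β) ≡ 2 ^ s * 𝟏 L (α , β)
    conv≡ α β = trans (conv-cong (λ i γ → sym (proj₂ (unique i) (β , γ))) (residue (ε root) α β))
                      (conv-lines (ε root) ls α β)
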